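{- Let $m$ and $n$ be natural numbers and let $D$ be an $m\times n$ diagram. Then $\det(M(D))$ is either $0$ or a power of $4$ (that is, $4^k$ for some integer $k\ge 0$).
   Context: An $m\times n$ diagram is an $m\times n$ grid of $mn$ squares in which each square is colored either black or white. If $D$ has $N$ white squares, label the white squares $1,\dots,N$ so that labels increase strictly from left to right along each row and every white square in a higher row has a smaller label than every white square in a lower row. The skew-adjacency matrix $M(D)$ is the $N\times N$ integer matrix whose $(i,j)$ entry is: (1) $1$ if the square labelled $i$ is strictly to the left of and in the same row as the square labelled $j$, or is strictly above and in the same column as the square labelled $j$; (2) $-1$ if the square labelled $i$ is strictly to the right of and in the same row as the square labelled $j$, or is strictly below and in the same column as the square labelled $j$; (3) $0$ otherwise. The determinant of the $0\times 0$ matrix (no white squares) is $1$. -}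

module Defs where

open import Algebra.Definitions.RawMonoid using (sum)
open import Data.Bool.Base using (if_then_else_)
open import Data.Fin.Base using (Fin; zero; suc; toℕ; _<_)
open import Data.Fin.Properties using (_≟_; _<?_)
open import Data.Integer.Base using (ℤ; 0ℤ; 1ℤ; -1ℤ; _*_; _^_; +-0-rawMonoid)
open import Data.List.Base using (List; allFin; cartesianProduct; filter; length; lookup)
open import Data.Nat.Base using (ℕ; zero; suc)
open import Data.Product.Base using (_×_; proj₁; proj₂)
open import Data.Sum.Base using (_⊎_)
open import Data.Vec.Functional using (Vector; removeAt)
open import Relation.Binary.PropositionalEquality using (_≡_; refl)
open import Relation.Nullary.Decidable using (Dec; yes; no; does; _×-dec_; _⊎-dec_)

SquareMatrix : ℕ → Set
SquareMatrix n = Vector (Vector ℤ n) n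

-- Cofactor expansion along the first row.
det : ∀ n → SquareMatrix n → ℤ
det zero    A = 1ℤ
det (suc n) A = sum +-0-rawMonoid λ (j : Fin (suc n)) →
  -1ℤ ^ toℕ j * A zero j * det n (λ i → removeAt (A (suc i)) j)

data Colour : Set where
  black white : Colour

isWhite? : (c : Colour) → Dec (c ≡ white)
isWhite? black = no λ ()
isWhite? white = yes refl

-- Row 0 is the top row and column 0 is the leftmost column.
Diagram : ℕ → ℕ → Set
Diagram m n = Fin m → Fin n → Colour

Square : ℕ → ℕ → Set
Square m n = Fin m × Fin n

module _ {m n : ℕ} where

  row : Square m n → Fin m
  row = proj₁

  col : Square m n → Fin n
  col = proj₂

  LeftOf : Square m n → Square m n → Set
  LeftOf s t = row s ≡ row t × col s < col t

  Above : Square m n → Square m n → Set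
  Above s t = col s ≡ col t × row s < row t

  Precedes : Square m n → Square m n → Set
  Precedes s t = LeftOf s t ⊎ Above s t

  precedes? : ∀ s t → Dec (Precedes s t)
  precedes? s t =
    (row s ≟ row t ×-dec col s <? col t) ⊎-dec (col s ≟ col t ×-dec row s <? row t)

  -- The entry -1 is governed by Precedes t s: s is right of t exactly when t is
  -- left of s, and s is below t exactly when t is above s.
  entry : Square m n → Square m n → ℤ
  entry s t =
    if does (precedes? s t) then 1ℤ else
    if does (precedes? t s) then -1ℤ else 0ℤ

  -- cartesianProduct lists the squares row by row from the top, and from left to
  -- right within each row, so a white square's position in this list (counted
  -- from 0 rather than 1) is its label.
  whiteSquares : Diagram m n → List (Square m n)
  whiteSquares D =
    filter (λ s → isWhite? (D (row s) (col s))) (cartesianProduct (allFin m) (allFin n))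

  #white : Diagram m n → ℕ
  #white D = length (whiteSquares D)

  skewAdjacency : (D : Diagram m n) → SquareMatrix (#white D)
  skewAdjacency D i j = entry (lookup (whiteSquares D) i) (lookup (whiteSquares D) j)

{-# OPTIONS --safe #-}
-- To the white square s in row r and column c attach the root b_s = e_r - e_c in ℤ^K,
-- K = m + n. Distinct squares have ⟨ b_s , b_t ⟩ = 1 if they share a row or a column and
-- 0 otherwise, while ⟨ b_s , b_s ⟩ = 2. So M(D) = L - Lᵀ = 2L - B Bᵀ, where the N rows of
-- B are the b_s and L is upper unitriangular with L + Lᵀ = B Bᵀ. Computing
-- the determinant of the block matrix [ 2L , B ; 2Bᵀ , 2I ] in two ways gives
--   2^K det M(D) = 2^N det (I + w),
-- where w is the product of the reflections in the b_s (a Coxeter element). These are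
-- transpositions, so w is a permutation of sign (-1)^N. A cycle of length ℓ contributes
-- 1 - (-1)^ℓ to det (I + w), which is therefore 0 or 2^c with c the number of cycles, and
-- (-1)^(K - c) = (-1)^N shows that the exponent N + c - K of det M(D) is even.

module Submission where

open import Defs
open import Data.Bool.Base using (true; false; if_then_else_)
open import Data.Fin.Base using (Fin; zero; suc; toℕ; punchIn; punchOut; pinch; splitAt; _<_; _↑ˡ_; _↑ʳ_)
open import Data.Fin.Permutation.Components using (transpose; transpose-inverse)
open import Data.Fin.Properties using (_≟_; suc-injective; 0≢1+n; <-irrefl; <-asym; <⇒≢; ↑ˡ-injective; ↑ʳ-injective; punchIn-punchOut; toℕ-↑ˡ; splitAt-↑ˡ; splitAt-↑ʳ; splitAt⁻¹-↑ˡ; splitAt⁻¹-↑ʳ)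
open import Data.Integer.Base using (ℤ; 0ℤ; 1ℤ; -1ℤ; +_; _+_; _*_; _-_; -_; _^_; ∣_∣)
import Data.Integer.Properties as ℤ
open import Data.Integer.Solver using (module +-*-Solver)
open import Data.List.Base using (List; []; _∷_; length; lookup; cartesianProduct)
open import Data.List.Membership.Propositional.Properties using (∈-lookup)
open import Data.List.Relation.Unary.All as All using ()
open import Data.List.Relation.Unary.All.Properties as All using ()
open import Data.List.Relation.Unary.AllPairs as AllPairsBase using (AllPairs; []; _∷_)
import Data.List.Relation.Unary.AllPairs.Properties as AllPairs
open import Data.Nat.Base using (ℕ; zero; suc)
import Data.Nat.Base as ℕ
import Data.Nat.Properties as ℕ
open import Data.Product.Base using (_×_; _,_; proj₁; proj₂; ∃-syntax)
open import Data.Product.Relation.Binary.Lex.Strict using (×-Lex)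
open import Data.Sum.Base using (_⊎_; inj₁; inj₂)
open import Data.Vec.Functional using (Vector; removeAt) renaming (_∷_ to _∷ᵛ_; _++_ to _++ᵛ_)
open import Data.Vec.Functional.Properties using (lookup-++ˡ; lookup-++ʳ)
open import Function.Base using (_∘_; id)
open import Relation.Binary.PropositionalEquality using (_≡_; _≢_; _≗_; refl; sym; trans; cong; cong₂; setoid; module ≡-Reasoning)
open import Relation.Nullary.Decidable using (Dec; does; yes; no; dec-true; dec-false)
open import Relation.Nullary.Negation using (¬_; contradiction)
open import Algebra.Properties.Semiring.Sum ℤ.+-*-semiring using (sum; ∑-distrib-+; *-distribˡ-sum; *-distribʳ-sum; sum-cong-≗; sum-replicate-zero)
open +-*-Solver

private
  variable
    n K : ℕ

-- Determinants

sgn : Fin n → ℤ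
sgn j = -1ℤ ^ toℕ j

minor : SquareMatrix (suc n) → Fin (suc n) → SquareMatrix n
minor A j i = removeAt (A (suc i)) j

sum-zero : {f : Vector ℤ n} → (∀ j → f j ≡ 0ℤ) → sum f ≡ 0ℤ
sum-zero {n} f≗0 = trans (sum-cong-≗ f≗0) (sum-replicate-zero n)

det-cong : ∀ n {A B : SquareMatrix n} → (∀ i → A i ≗ B i) → det n A ≡ det n B
det-cong zero    A≗B = refl
det-cong (suc n) A≗B = sum-cong-≗ λ j →
  cong₂ _*_ (cong (sgn j *_) (A≗B zero j)) (det-cong n λ i k → A≗B (suc i) (punchIn j k))

-- Induction along the first-row expansion. If `i` is the top row, the three matrices share their
-- minors and only the coefficient varies; otherwise the coefficient is shared and linearity passes
-- through the minors.
det-linear : ∀ {n} (i : Fin n) {A B C : SquareMatrix n} a b →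
  (∀ j → j ≢ i → A j ≗ C j) → (∀ j → j ≢ i → B j ≗ C j) →
  (∀ k → C i k ≡ a * A i k + b * B i k) → det n C ≡ a * det n A + b * det n B
det-linear {suc n} i {A} {B} {C} a b A≗C B≗C Cᵢ = begin
  sum (λ j → t C j)                           ≡⟨ sum-cong-≗ (term i A≗C B≗C Cᵢ) ⟩
  sum (λ j → a * t A j + b * t B j)           ≡⟨ ∑-distrib-+ (λ j → a * t A j) (λ j → b * t B j) ⟩
  sum (λ j → a * t A j) + sum (λ j → b * t B j)
    ≡⟨ cong₂ _+_ (*-distribˡ-sum a (t A)) (*-distribˡ-sum b (t B)) ⟨
  a * sum (t A) + b * sum (t B) ∎
  where
  open ≡-Reasoning
  t : SquareMatrix (suc n) → Vector ℤ (suc n)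
  t X j = sgn j * X zero j * det n (minor X j)
  term : ∀ i → (∀ j → j ≢ i → A j ≗ C j) → (∀ j → j ≢ i → B j ≗ C j) →
    (∀ k → C i k ≡ a * A i k + b * B i k) → ∀ j → t C j ≡ a * t A j + b * t B j
  term zero A≗C B≗C Cᵢ j = begin
    sgn j * C zero j * det n (minor C j)
      ≡⟨ cong (λ x → sgn j * x * det n (minor C j)) (Cᵢ j) ⟩
    sgn j * (a * A zero j + b * B zero j) * det n (minor C j)
      ≡⟨ solve 6 (λ s a x b y d → s :* (a :* x :+ b :* y) :* d := a :* (s :* x :* d) :+ b :* (s :* y :* d)) refl
           (sgn j) a (A zero j) b (B zero j) (det n (minor C j)) ⟩
    a * (sgn j * A zero j * det n (minor C j)) + b * (sgn j * B zero j * det n (minor C j))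
      ≡⟨ cong₂ (λ x y → a * (sgn j * A zero j * x) + b * (sgn j * B zero j * y))
           (det-cong n λ i k → A≗C (suc i) (λ ()) (punchIn j k))
           (det-cong n λ i k → B≗C (suc i) (λ ()) (punchIn j k)) ⟨
    a * t A j + b * t B j ∎
  term (suc i) A≗C B≗C Cᵢ j = begin
    sgn j * C zero j * det n (minor C j)
      ≡⟨ cong (sgn j * C zero j *_) (det-linear i a b
           (λ l l≢i k → A≗C (suc l) (l≢i ∘ suc-injective) (punchIn j k))
           (λ l l≢i k → B≗C (suc l) (l≢i ∘ suc-injective) (punchIn j k))
           (λ k → Cᵢ (punchIn j k))) ⟩
    sgn j * C zero j * (a * det n (minor A j) + b * det n (minor B j))
      ≡⟨ solve 6 (λ s c a x b y → s :* c :* (a :* x :+ b :* y) := a :* (s :* c :* x) :+ b :* (s :* c :* y)) refl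
           (sgn j) (C zero j) a (det n (minor A j)) b (det n (minor B j)) ⟩
    a * (sgn j * C zero j * det n (minor A j)) + b * (sgn j * C zero j * det n (minor B j))
      ≡⟨ cong₂ (λ x y → a * (sgn j * x * det n (minor A j)) + b * (sgn j * y * det n (minor B j)))
           (A≗C zero (λ ()) j) (B≗C zero (λ ()) j) ⟨
    a * t A j + b * t B j ∎

-- Exchanging rows

punchIn-pinch : (j : Fin (suc n)) (k : Fin n) → punchIn (punchIn j k) (pinch k j) ≡ j
punchIn-pinch zero    zero    = refl
punchIn-pinch zero    (suc k) = refl
punchIn-pinch (suc j) zero    = refl
punchIn-pinch (suc j) (suc k) = cong suc (punchIn-pinch j k)

-- Deleting two columns in either order leaves the same columns: `pinch k j` is the index that
-- column `j` receives once column `punchIn j k` is gone.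
punchIn-comm : (j : Fin (suc (suc n))) (k : Fin (suc n)) →
  punchIn j ∘ punchIn k ≗ punchIn (punchIn j k) ∘ punchIn (pinch k j)
punchIn-comm zero    zero    x       = refl
punchIn-comm zero    (suc k) x       = refl
punchIn-comm (suc j) zero    x       = refl
punchIn-comm (suc j) (suc k) zero    = refl
punchIn-comm {suc n} (suc j) (suc k) (suc x) = cong suc (punchIn-comm j k x)

-- The pairs (j , k) and (punchIn j k , pinch k j) enumerate the same two-element
-- set of columns in the two possible orders, with opposite signs.
altSum-swap : ∀ n (H G : Fin (suc n) → Fin n → ℤ) →
  (∀ j k → H j k ≡ G (punchIn j k) (pinch k j)) →
  sum (λ j → sum (λ k → sgn j * sgn k * H j k)) ≡
  - sum (λ j → sum (λ k → sgn j * sgn k * G j k))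
altSum-swap zero    H G H≡G = refl
altSum-swap (suc n) H G H≡G = begin
  S H                ≡⟨ split H ⟩
  -- The exchange of indices sends `(zero , k)` to `(suc k , zero)` and back, so `P` and `Q` trade
  -- places. It preserves the pairs of nonzero indices, where induction applies.
  P H - Q H + R H    ≡⟨ cong₂ _+_ (cong₂ _-_ (sum-cong-≗ λ k → cong (sgn k *_) (H≡G zero k))
                          (sum-cong-≗ λ k → cong (sgn k *_) (H≡G (suc k) zero)))
                          (altSum-swap n (λ j k → H (suc j) (suc k)) (λ j k → G (suc j) (suc k)) λ j k → H≡G (suc j) (suc k)) ⟩
  Q G - P G - R G    ≡⟨ solve 3 (λ p q r → q :- p :- r := :- (p :- q :+ r)) refl (P G) (Q G) (R G) ⟩
  - (P G - Q G + R G) ≡⟨ cong -_ (split G) ⟨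
  - S G ∎
  where
  open ≡-Reasoning
  S P Q R : (Fin (suc (suc n)) → Fin (suc n) → ℤ) → ℤ
  S H = sum λ j → sum λ k → sgn j * sgn k * H j k
  P H = sum λ k → sgn k * H zero k
  Q H = sum λ j → sgn j * H (suc j) zero
  R H = sum λ j → sum λ k → sgn j * sgn k * H (suc j) (suc k)
  split : ∀ H → S H ≡ P H - Q H + R H
  split H = begin
    sum (λ k → 1ℤ * sgn k * H zero k) +
    sum (λ j → sgn (suc j) * 1ℤ * H (suc j) zero + sum λ k → sgn (suc j) * sgn (suc k) * H (suc j) (suc k))
      ≡⟨ cong₂ _+_ (sum-cong-≗ λ k → cong (_* H zero k) (ℤ.*-identityˡ (sgn k)))
           (sum-cong-≗ λ j → cong₂ _+_
             (solve 2 (λ s h → con -1ℤ :* s :* con 1ℤ :* h := con -1ℤ :* (s :* h)) refl (sgn j) (H (suc j) zero))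
             (sum-cong-≗ λ k → solve 3 (λ s t h → con -1ℤ :* s :* (con -1ℤ :* t) :* h := s :* t :* h) refl
               (sgn j) (sgn k) (H (suc j) (suc k)))) ⟩
    P H + sum (λ j → -1ℤ * (sgn j * H (suc j) zero) + sum λ k → sgn j * sgn k * H (suc j) (suc k))
      ≡⟨ cong (λ x → P H + x) (∑-distrib-+ (λ j → -1ℤ * (sgn j * H (suc j) zero)) (λ j → sum λ k → sgn j * sgn k * H (suc j) (suc k))) ⟩
    P H + (sum (λ j → -1ℤ * (sgn j * H (suc j) zero)) + R H)
      ≡⟨ cong (λ x → P H + (x + R H)) (*-distribˡ-sum -1ℤ (λ j → sgn j * H (suc j) zero)) ⟨
    P H + (-1ℤ * Q H + R H)
      ≡⟨ solve 3 (λ p q r → p :+ (con -1ℤ :* q :+ r) := p :- q :+ r) refl (P H) (Q H) (R H) ⟩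
    P H - Q H + R H ∎

-- Expanding along two rows gives a signed sum over ordered pairs of distinct columns. Exchanging
-- the two rows amounts to exchanging the columns in each pair.
det-swap₀₁ : ∀ n (A : SquareMatrix (suc (suc n))) →
  det _ (A ∘ transpose zero (suc zero)) ≡ - det _ A
det-swap₀₁ n A = begin
  det _ (A ∘ transpose zero (suc zero))     ≡⟨ expand (A ∘ transpose zero (suc zero)) ⟩
  sum (λ j → sum λ k → sgn j * sgn k * H (A (suc zero)) (A zero) j k)
    ≡⟨ altSum-swap (suc n) (H (A (suc zero)) (A zero)) (H (A zero) (A (suc zero))) sym-H ⟩
  - sum (λ j → sum λ k → sgn j * sgn k * H (A zero) (A (suc zero)) j k)
    ≡⟨ cong -_ (expand A) ⟨
  - det _ A ∎
  where
  open ≡-Reasoning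
  H : (u v : Vector ℤ (suc (suc n))) → Fin (suc (suc n)) → Fin (suc n) → ℤ
  H u v j k = u j * v (punchIn j k) * det n λ i x → A (suc (suc i)) (punchIn j (punchIn k x))
  sym-H : ∀ j k → H (A (suc zero)) (A zero) j k ≡ H (A zero) (A (suc zero)) (punchIn j k) (pinch k j)
  sym-H j k = cong₂ _*_
    (trans (cong (λ l → A (suc zero) l * A zero (punchIn j k)) (sym (punchIn-pinch j k)))
      (ℤ.*-comm (A (suc zero) (punchIn (punchIn j k) (pinch k j))) (A zero (punchIn j k))))
    (det-cong n λ i x → cong (A (suc (suc i))) (punchIn-comm j k x))
  expand : ∀ B → det _ B ≡ sum λ j → sum λ k → sgn j * sgn k *
    (B zero j * B (suc zero) (punchIn j k) * det n λ i x → B (suc (suc i)) (punchIn j (punchIn k x)))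
  expand B = sum-cong-≗ λ j → begin
    sgn j * B zero j * sum (λ k → sgn k * B (suc zero) (punchIn j k) * D j k)
      ≡⟨ *-distribˡ-sum (sgn j * B zero j) (λ k → sgn k * B (suc zero) (punchIn j k) * D j k) ⟩
    sum (λ k → sgn j * B zero j * (sgn k * B (suc zero) (punchIn j k) * D j k))
      ≡⟨ sum-cong-≗ (λ k → solve 5 (λ s b t c d → s :* b :* (t :* c :* d) := s :* t :* (b :* c :* d)) refl
           (sgn j) (B zero j) (sgn k) (B (suc zero) (punchIn j k)) (D j k)) ⟩
    sum (λ k → sgn j * sgn k * (B zero j * B (suc zero) (punchIn j k) * D j k)) ∎
    where
    D : Fin (suc (suc n)) → Fin (suc n) → ℤ
    D j k = det n λ i x → B (suc (suc i)) (punchIn j (punchIn k x))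

transpose-suc : (i j k : Fin n) → transpose (suc i) (suc j) (suc k) ≡ suc (transpose i j k)
transpose-suc i j k with does (k ≟ i)
... | true  = refl
... | false with does (k ≟ j)
...   | true  = refl
...   | false = refl

transpose-matchˡ : (i j : Fin n) → transpose i j i ≡ j
transpose-matchˡ i j rewrite dec-true (i ≟ i) refl = refl

transpose-matchʳ : (i j : Fin n) → transpose i j j ≡ i
transpose-matchʳ i j with j ≟ i
... | yes refl = refl
... | no  _    rewrite dec-true (j ≟ j) refl = refl

transpose-mismatch : (i j : Fin n) {k : Fin n} → k ≢ i → k ≢ j → transpose i j k ≡ k
transpose-mismatch i j {k} k≢i k≢j rewrite dec-false (k ≟ i) k≢i | dec-false (k ≟ j) k≢j = refl

transpose-comm : (i j k : Fin n) → transpose i j k ≡ transpose j i k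
transpose-comm i j k = compare (k ≟ i) (k ≟ j)
  where
  compare : Dec (k ≡ i) → Dec (k ≡ j) → transpose i j k ≡ transpose j i k
  compare (yes refl) _          = trans (transpose-matchˡ k j) (sym (transpose-matchʳ j k))
  compare (no _)     (yes refl) = trans (transpose-matchʳ i k) (sym (transpose-matchˡ k i))
  compare (no k≢i)   (no k≢j)   = trans (transpose-mismatch i j k≢i k≢j) (sym (transpose-mismatch j i k≢j k≢i))

-- Reduces an exchange with the top row to an exchange of the two topmost rows and two exchanges
-- below the top row, which the induction on the size covers.
transpose-conj : (j : Fin n) (k : Fin (suc (suc n))) →
  transpose (suc zero) (suc (suc j)) (transpose zero (suc zero) (transpose (suc zero) (suc (suc j)) k)) ≡
  transpose zero (suc (suc j)) k
transpose-conj j zero       = refl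
transpose-conj j (suc zero) rewrite dec-true (j ≟ j) refl = refl
transpose-conj j (suc (suc k)) with does (k ≟ j) in eq
... | true  = refl
... | false rewrite eq = refl

SwapNegates : ℕ → Set
SwapNegates n = (i j : Fin n) → i ≢ j → (A : SquareMatrix n) → det n (A ∘ transpose i j) ≡ - det n A

-- The top row stays in place, and every minor along it undergoes the same exchange.
det-swap-suc : SwapNegates n → (i j : Fin n) → i ≢ j → (A : SquareMatrix (suc n)) →
  det (suc n) (A ∘ transpose (suc i) (suc j)) ≡ - det (suc n) A
det-swap-suc {n} swap i j i≢j A = begin
  sum (λ l → sgn l * A zero l * det n (minor (A ∘ transpose (suc i) (suc j)) l))
    ≡⟨ sum-cong-≗ (λ l → trans
         (cong (sgn l * A zero l *_) (trans
           (det-cong n λ k x → cong (λ r → A r (punchIn l x)) (transpose-suc i j k))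
           (swap i j i≢j (minor A l))))
         (solve 2 (λ a b → a :* (:- b) := con -1ℤ :* (a :* b)) refl (sgn l * A zero l) (det n (minor A l)))) ⟩
  sum (λ l → -1ℤ * (sgn l * A zero l * det n (minor A l)))
    ≡⟨ *-distribˡ-sum -1ℤ (λ l → sgn l * A zero l * det n (minor A l)) ⟨
  -1ℤ * det (suc n) A ≡⟨ ℤ.-1*i≡-i (det (suc n) A) ⟩
  - det (suc n) A ∎
  where open ≡-Reasoning

det-swap-zero : SwapNegates n → (j : Fin n) (A : SquareMatrix (suc n)) →
  det (suc n) (A ∘ transpose zero (suc j)) ≡ - det (suc n) A
det-swap-zero {suc n} swap zero    A = det-swap₀₁ n A
det-swap-zero {suc n} swap (suc j) A = begin
  det _ (A ∘ transpose zero 2+j)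
    ≡⟨ det-cong _ (λ k l → cong (λ r → A r l) (transpose-conj j k)) ⟨
  det _ (A ∘ transpose one 2+j ∘ transpose zero one ∘ transpose one 2+j)
    ≡⟨ swap₁ⱼ (A ∘ transpose one 2+j ∘ transpose zero one) ⟩
  - det _ (A ∘ transpose one 2+j ∘ transpose zero one)
    ≡⟨ cong -_ (det-swap₀₁ n (A ∘ transpose one 2+j)) ⟩
  - - det _ (A ∘ transpose one 2+j)
    ≡⟨ cong (-_ ∘ -_) (swap₁ⱼ A) ⟩
  - - - det _ A
    ≡⟨ ℤ.neg-involutive (- det _ A) ⟩
  - det _ A ∎
  where
  open ≡-Reasoning
  one 2+j : Fin (suc (suc n))
  one = suc zero
  2+j = suc (suc j)
  swap₁ⱼ : (B : SquareMatrix (suc (suc n))) → det _ (B ∘ transpose one 2+j) ≡ - det _ B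
  swap₁ⱼ = det-swap-suc swap zero (suc j) (λ ())

det-swap : ∀ n → SwapNegates n
det-swap (suc n) zero    zero    i≢j A = contradiction refl i≢j
det-swap (suc n) (suc i) (suc j) i≢j A = det-swap-suc (det-swap n) i j (i≢j ∘ cong suc) A
det-swap (suc n) zero    (suc j) i≢j A = det-swap-zero (det-swap n) j A
det-swap (suc n) (suc i) zero    i≢j A =
  trans (det-cong (suc n) λ k l → cong (λ r → A r l) (transpose-comm (suc i) zero k))
    (det-swap-zero (det-swap n) i A)

≡-⇒≡0 : ∀ i → i ≡ - i → i ≡ 0ℤ
-- For nonzero `i` the two sides have different constructors.
≡-⇒≡0 (+ zero) _ = refl

-- Exchanging equal rows changes nothing, so the determinant equals its own negative, and ℤ has no
-- 2-torsion.
det-repeatedRow : (i j : Fin n) → i ≢ j → (A : SquareMatrix n) → A i ≗ A j → det n A ≡ 0ℤ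
det-repeatedRow {n} i j i≢j A Aᵢ≗Aⱼ =
  ≡-⇒≡0 (det n A) (trans (det-cong n (λ k → same k (k ≟ i) (k ≟ j))) (det-swap n i j i≢j A))
  where
  same : ∀ k → Dec (k ≡ i) → Dec (k ≡ j) → A k ≗ A (transpose i j k)
  same k (yes refl) _          rewrite transpose-matchˡ k j = Aᵢ≗Aⱼ
  same k (no _)     (yes refl) rewrite transpose-matchʳ i k = sym ∘ Aᵢ≗Aⱼ
  same k (no k≢i)   (no k≢j)   rewrite transpose-mismatch i j k≢i k≢j = λ _ → refl

det-addRow : (i k : Fin n) → i ≢ k → ∀ c {A B : SquareMatrix n} →
  (∀ j → j ≢ i → B j ≗ A j) → (∀ l → B i l ≡ A i l + c * A k l) → det n B ≡ det n A
det-addRow {n} i k i≢k c {A} {B} B≗A Bᵢ = begin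
  det n B
    ≡⟨ det-linear i 1ℤ c (λ j j≢i l → sym (B≗A j j≢i l))
         (λ j j≢i l → trans (cong (λ r → A r l) (ρ-other j≢i)) (sym (B≗A j j≢i l)))
         (λ l → trans (Bᵢ l) (cong₂ (λ x y → x + c * y) (sym (ℤ.*-identityˡ (A i l))) (cong (λ r → A r l) (sym ρ-i)))) ⟩
  1ℤ * det n A + c * det n (A ∘ ρ)
    ≡⟨ cong (λ x → 1ℤ * det n A + c * x) (det-repeatedRow i k i≢k (A ∘ ρ)
         λ l → cong (λ r → A r l) (trans ρ-i (sym (ρ-other (i≢k ∘ sym))))) ⟩
  1ℤ * det n A + c * 0ℤ
    ≡⟨ solve 2 (λ a c → con 1ℤ :* a :+ c :* con 0ℤ := a) refl (det n A) c ⟩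
  det n A ∎
  where
  open ≡-Reasoning
  -- `A ∘ ρ` is `A` with row `i` overwritten by row `k`; this is the summand that linearity splits
  -- off and that has a repeated row.
  ρ : Fin n → Fin n
  ρ j = if does (j ≟ i) then k else j
  ρ-i : ρ i ≡ k
  ρ-i rewrite dec-true (i ≟ i) refl = refl
  ρ-other : ∀ {j} → j ≢ i → ρ j ≡ j
  ρ-other {j} j≢i rewrite dec-false (j ≟ i) j≢i = refl

-- Lifts invariance under changing one row to changing all of them, one after the other. `F-cong`
-- stands in for function extensionality. In both uses the row being added lies outside `R`, so it
-- is intact at every stage.
changeRows : ∀ {N} (Q : Vector ℤ n → Vector ℤ n → Set) (F : Vector (Vector ℤ n) N → ℤ) →
  (∀ {R R′} → (∀ i → R′ i ≗ R i) → F R′ ≡ F R) →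
  (∀ i {R R′} → (∀ j → j ≢ i → R′ j ≗ R j) → Q (R i) (R′ i) → F R′ ≡ F R) →
  ∀ {R R′} → (∀ i → Q (R i) (R′ i)) → F R′ ≡ F R
changeRows {N = zero}  Q F F-cong F-change q = F-cong λ ()
changeRows {N = suc N} Q F F-cong F-change {R} {R′} q = begin
  F R′               ≡⟨ F-cong (λ { zero l → refl ; (suc j) l → refl }) ⟩
  F (R′ zero ∷ᵛ R′ ∘ suc)
    ≡⟨ changeRows Q (λ T → F (R′ zero ∷ᵛ T))
         (λ T≗ → F-cong λ { zero l → refl ; (suc j) l → T≗ j l })
         (λ i T≗ → F-change (suc i) λ { zero _ l → refl ; (suc j) j≢i l → T≗ j (j≢i ∘ cong suc) l })
         (q ∘ suc) ⟩
  F (R′ zero ∷ᵛ R ∘ suc)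
    ≡⟨ F-change zero (λ { zero 0≢0 l → contradiction refl 0≢0 ; (suc j) _ l → refl }) (q zero) ⟩
  F R ∎
  where open ≡-Reasoning

-- In the expansion, the term for `j` vanishes by its entry, and every other minor keeps a zero
-- column, at `punchOut l≢j`.
det-zeroColumn : ∀ n (j : Fin n) {A : SquareMatrix n} → (∀ i → A i j ≡ 0ℤ) → det n A ≡ 0ℤ
det-zeroColumn (suc n) j {A} Aⱼ≡0 = sum-zero λ l → term l (l ≟ j)
  where
  term : ∀ l → Dec (l ≡ j) → sgn l * A zero l * det n (minor A l) ≡ 0ℤ
  term l (yes refl) rewrite Aⱼ≡0 zero | ℤ.*-zeroʳ (sgn l) = refl
  term l (no l≢j) = trans
    (cong (sgn l * A zero l *_) (det-zeroColumn n (punchOut l≢j) {minor A l}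
      λ i → trans (cong (A (suc i)) (punchIn-punchOut l≢j)) (Aⱼ≡0 (suc i))))
    (ℤ.*-zeroʳ (sgn l * A zero l))

det-firstColumn : (A : SquareMatrix (suc n)) → (∀ i → A (suc i) zero ≡ 0ℤ) →
  det (suc n) A ≡ A zero zero * det n (λ i j → A (suc i) (suc j))
det-firstColumn {n} A A₀≡0 = begin
  1ℤ * A zero zero * D + sum (λ j → sgn (suc j) * A zero (suc j) * det n (minor A (suc j)))
    ≡⟨ cong (λ x → 1ℤ * A zero zero * D + x) (sum-zero λ j → vanish j A A₀≡0) ⟩
  1ℤ * A zero zero * D + 0ℤ
    ≡⟨ solve 2 (λ a d → con 1ℤ :* a :* d :+ con 0ℤ := a :* d) refl (A zero zero) D ⟩
  A zero zero * D ∎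
  where
  open ≡-Reasoning
  D = det n (λ i j → A (suc i) (suc j))
  -- Generalised over `n` so that the index `j` can force it to be a successor; the minor then still
  -- has column `zero`.
  vanish : ∀ {n} (j : Fin n) (A : SquareMatrix (suc n)) → (∀ i → A (suc i) zero ≡ 0ℤ) →
    sgn (suc j) * A zero (suc j) * det n (minor A (suc j)) ≡ 0ℤ
  vanish {suc n} j A A₀≡0 = trans
    (cong (sgn (suc j) * A zero (suc j) *_) (det-zeroColumn (suc n) zero {minor A (suc j)} A₀≡0))
    (ℤ.*-zeroʳ (sgn (suc j) * A zero (suc j)))

-- Gaussian elimination on column zero, leaving the Schur complement of the corner. The multipliers
-- `c` are given as data because the pivot need not be invertible in ℤ.
det-pivot : (A : SquareMatrix (suc n)) (c : Vector ℤ n) →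
  (∀ i → A (suc i) zero ≡ c i * A zero zero) →
  det (suc n) A ≡ A zero zero * det n (λ i j → A (suc i) (suc j) - c i * A zero (suc j))
det-pivot {n} A c A₀ = begin
  det (suc n) A
    ≡⟨ det-cong (suc n) {A} {A zero ∷ᵛ A ∘ suc} (λ { zero l → refl ; (suc i) l → refl }) ⟩
  det (suc n) (A zero ∷ᵛ A ∘ suc)
    ≡⟨ changeRows Cleared (λ R → det (suc n) (A zero ∷ᵛ R))
         (λ {R} {R′} R≗ → det-cong (suc n) {A zero ∷ᵛ R′} {A zero ∷ᵛ R} λ { zero l → refl ; (suc i) l → R≗ i l })
         (λ i {R} {R′} R≗ (d , R′ᵢ) → det-addRow (suc i) zero (λ ()) (- d) {A zero ∷ᵛ R} {A zero ∷ᵛ R′}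
           (λ { zero _ l → refl ; (suc j) j≢i l → R≗ j (j≢i ∘ cong suc) l })
           (λ l → trans (R′ᵢ l) (cong (λ x → R i l + x) (ℤ.neg-distribˡ-* d (A zero l)))))
         {A ∘ suc} {cleared}
         (λ i → c i , λ l → refl) ⟨
  det (suc n) (A zero ∷ᵛ cleared)
    ≡⟨ det-firstColumn (A zero ∷ᵛ cleared) (λ i → ℤ.i≡j⇒i-j≡0 (A₀ i)) ⟩
  A zero zero * det n (λ i j → A (suc i) (suc j) - c i * A zero (suc j)) ∎
  where
  open ≡-Reasoning
  cleared : Vector (Vector ℤ (suc n)) n
  cleared i l = A (suc i) l - c i * A zero l
  Cleared : Vector ℤ (suc n) → Vector ℤ (suc n) → Set
  Cleared r r′ = ∃[ d ] ∀ l → r′ l ≡ r l - d * A zero l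

-- Block matrices and scaling

sum-↑ˡ : ∀ N {K} (f : Vector ℤ (N ℕ.+ K)) → (∀ k → f (N ↑ʳ k) ≡ 0ℤ) →
  sum f ≡ sum (λ j → f (j ↑ˡ K))
sum-↑ˡ zero    f f≡0 = sum-zero f≡0
sum-↑ˡ (suc N) f f≡0 = cong (λ x → f zero + x) (sum-↑ˡ N (f ∘ suc) f≡0)

punchIn-↑ˡ : ∀ K (j : Fin (suc n)) (x : Fin n) → punchIn (j ↑ˡ K) (x ↑ˡ K) ≡ punchIn j x ↑ˡ K
punchIn-↑ˡ K zero    x       = refl
punchIn-↑ˡ K (suc j) zero    = refl
punchIn-↑ˡ K (suc j) (suc x) = cong suc (punchIn-↑ˡ K j x)

punchIn-↑ʳ : ∀ {K} (j : Fin (suc n)) (k : Fin K) → punchIn (j ↑ˡ K) (n ↑ʳ k) ≡ suc n ↑ʳ k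
punchIn-↑ʳ zero    k = refl
punchIn-↑ʳ {suc n} (suc j) k = cong suc (punchIn-↑ʳ j k)

sgn-↑ˡ : ∀ K (j : Fin n) → sgn (j ↑ˡ K) ≡ sgn j
sgn-↑ˡ K j = cong (-1ℤ ^_) (toℕ-↑ˡ j K)

-- Along the first row the right-hand columns contribute nothing; deleting a left-hand column
-- shrinks the upper left block and leaves the lower right one alone.
det-block : ∀ N {K} (A : SquareMatrix (N ℕ.+ K)) → (∀ i k → A (i ↑ˡ K) (N ↑ʳ k) ≡ 0ℤ) →
  det _ A ≡ det N (λ i j → A (i ↑ˡ K) (j ↑ˡ K)) * det K (λ i j → A (N ↑ʳ i) (N ↑ʳ j))
det-block zero {K}    A A≡0 = sym (ℤ.*-identityˡ (det K A))
det-block (suc N) {K} A A≡0 = begin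
  sum (λ j → sgn j * A zero j * det _ (minor A j))
    ≡⟨ sum-↑ˡ (suc N) (λ j → sgn j * A zero j * det _ (minor A j)) right ⟩
  sum (λ j → sgn (j ↑ˡ K) * A zero (j ↑ˡ K) * det _ (minor A (j ↑ˡ K)))
    ≡⟨ sum-cong-≗ left ⟩
  sum (λ j → sgn j * A zero (j ↑ˡ K) * det N (minor P j) * D)
    ≡⟨ *-distribʳ-sum D (λ j → sgn j * A zero (j ↑ˡ K) * det N (minor P j)) ⟨
  det (suc N) P * D ∎
  where
  open ≡-Reasoning
  P : SquareMatrix (suc N)
  P i j = A (i ↑ˡ K) (j ↑ˡ K)
  D = det K (λ i j → A (suc N ↑ʳ i) (suc N ↑ʳ j))
  right : ∀ k → sgn (suc N ↑ʳ k) * A zero (suc N ↑ʳ k) * det _ (minor A (suc N ↑ʳ k)) ≡ 0ℤ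
  right k rewrite A≡0 zero k | ℤ.*-zeroʳ (sgn (suc N ↑ʳ k)) = refl
  left : ∀ j → sgn (j ↑ˡ K) * A zero (j ↑ˡ K) * det _ (minor A (j ↑ˡ K)) ≡
    sgn j * A zero (j ↑ˡ K) * det N (minor P j) * D
  left j = begin
    sgn (j ↑ˡ K) * A zero (j ↑ˡ K) * det _ (minor A (j ↑ˡ K))
      ≡⟨ cong₂ (λ s d → s * A zero (j ↑ˡ K) * d) (sgn-↑ˡ K j) (det-block N (minor A (j ↑ˡ K))
           λ i k → trans (cong (A (suc (i ↑ˡ K))) (punchIn-↑ʳ j k)) (A≡0 (suc i) k)) ⟩
    sgn j * A zero (j ↑ˡ K) * (det N _ * det K _)
      ≡⟨ cong₂ (λ x y → sgn j * A zero (j ↑ˡ K) * (x * y))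
           (det-cong N λ i l → cong (A (suc (i ↑ˡ K))) (punchIn-↑ˡ K j l))
           (det-cong K λ i l → cong (A (suc (N ↑ʳ i))) (punchIn-↑ʳ j l)) ⟩
    sgn j * A zero (j ↑ˡ K) * (det N (minor P j) * D)
      ≡⟨ ℤ.*-assoc (sgn j * A zero (j ↑ˡ K)) (det N (minor P j)) D ⟨
    sgn j * A zero (j ↑ˡ K) * det N (minor P j) * D ∎

det-scale : ∀ n c {A B : SquareMatrix n} → (∀ i j → B i j ≡ c * A i j) → det n B ≡ c ^ n * det n A
det-scale zero    c B≡cA = refl
det-scale (suc n) c {A} {B} B≡cA = begin
  sum (λ j → sgn j * B zero j * det n (minor B j))
    ≡⟨ sum-cong-≗ (λ j → trans
         (cong₂ (λ x y → sgn j * x * y) (B≡cA zero j) (det-scale n c {minor A j} λ i k → B≡cA (suc i) (punchIn j k)))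
         (solve 5 (λ s c a p d → s :* (c :* a) :* (p :* d) := c :* p :* (s :* a :* d)) refl
           (sgn j) c (A zero j) (c ^ n) (det n (minor A j)))) ⟩
  sum (λ j → c ^ suc n * (sgn j * A zero j * det n (minor A j)))
    ≡⟨ *-distribˡ-sum (c ^ suc n) (λ j → sgn j * A zero j * det n (minor A j)) ⟨
  c ^ suc n * det (suc n) A ∎
  where open ≡-Reasoning

det-scaleBottom : ∀ N {K} c {A B : SquareMatrix (N ℕ.+ K)} → (∀ i → B (i ↑ˡ K) ≗ A (i ↑ˡ K)) →
  (∀ k j → B (N ↑ʳ k) j ≡ c * A (N ↑ʳ k) j) → det _ B ≡ c ^ K * det _ A
det-scaleBottom zero    {K} c top bottom = det-scale K c bottom
det-scaleBottom (suc N) {K} c {A} {B} top bottom = begin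
  sum (λ j → sgn j * B zero j * det _ (minor B j))
    ≡⟨ sum-cong-≗ (λ j → trans
         (cong₂ (λ x y → sgn j * x * y) (top zero j) (det-scaleBottom N c {minor A j} {minor B j}
           (λ i k → top (suc i) (punchIn j k)) (λ i k → bottom i (punchIn j k))))
         (solve 4 (λ s a p d → s :* a :* (p :* d) := p :* (s :* a :* d)) refl
           (sgn j) (A zero j) (c ^ K) (det _ (minor A j)))) ⟩
  sum (λ j → c ^ K * (sgn j * A zero j * det _ (minor A j)))
    ≡⟨ *-distribˡ-sum (c ^ K) (λ j → sgn j * A zero j * det _ (minor A j)) ⟨
  c ^ K * det _ A ∎
  where open ≡-Reasoning

-- Signed permutation matrices

δ : Fin n → Fin n → ℤ
δ i j = if does (i ≟ j) then 1ℤ else 0ℤ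

permMatrix : (Fin n → Fin n) → SquareMatrix n
permMatrix f i = δ (f i)

-- Signs are needed because pivoting on the index zero of I + w yields I + w′ where w′
-- bypasses zero and the entry that replaces the path through zero is negated.
1+signedPerm : (Fin n → Fin n) → Vector ℤ n → SquareMatrix n
1+signedPerm f ε i j = δ i j + ε i * δ (f i) j

det-permMatrix-fixed₀ : (f : Fin (suc n) → Fin (suc n)) (f′ : Fin n → Fin n) → f zero ≡ zero →
  (∀ i → f (suc i) ≡ suc (f′ i)) → det (suc n) (permMatrix f) ≡ det n (permMatrix f′)
det-permMatrix-fixed₀ {n} f f′ f0 fs = begin
  det (suc n) (permMatrix f)
    ≡⟨ det-firstColumn (permMatrix f) (λ i → cong (λ x → δ x zero) (fs i)) ⟩
  δ (f zero) zero * det n (λ i j → δ (f (suc i)) (suc j))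
    ≡⟨ cong₂ _*_ (cong (λ x → δ x zero) f0) (det-cong n λ i j → cong (λ x → δ x (suc j)) (fs i)) ⟩
  1ℤ * det n (permMatrix f′)
    ≡⟨ ℤ.*-identityˡ (det n (permMatrix f′)) ⟩
  det n (permMatrix f′) ∎
  where open ≡-Reasoning

-- Shortens the cycle of f through zero by bypassing zero, when a = f zero.
bypass : Fin n → Fin (suc n) → Fin n
bypass a zero    = a
bypass a (suc b) = b

suc-bypass : (a : Fin n) {x : Fin (suc n)} → x ≢ zero → x ≡ suc (bypass a x)
suc-bypass a {zero}  x≢0 = contradiction refl x≢0
suc-bypass a {suc x} x≢0 = refl

IsSign : ℤ → Set
IsSign ε = ε ≡ 1ℤ ⊎ ε ≡ -1ℤ

neg-*-isSign : ∀ {a b} → IsSign a → IsSign b → IsSign (- (a * b))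
neg-*-isSign (inj₁ refl) (inj₁ refl) = inj₂ refl
neg-*-isSign (inj₁ refl) (inj₂ refl) = inj₁ refl
neg-*-isSign (inj₂ refl) (inj₁ refl) = inj₁ refl
neg-*-isSign (inj₂ refl) (inj₂ refl) = inj₂ refl

-- In the second case every cycle contributes a factor 2 to the determinant, so the
-- exponent is the number of cycles, whose parity is determined by the sign of f.
ZeroOr2^cycles : ∀ n → (Fin n → Fin n) → Vector ℤ n → Set
ZeroOr2^cycles n f ε = det n (1+signedPerm f ε) ≡ 0ℤ ⊎
  (∃[ c ] (det n (1+signedPerm f ε) ≡ (+ 2) ^ c × -1ℤ ^ n * det n (permMatrix f) ≡ -1ℤ ^ c))

-- Induction that removes the index zero. If `f` fixes it, a factor `1 + ε zero`, which is 2 or 0,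
-- splits off. Otherwise the corner is 1, and pivoting on it shortens the cycle through zero: the
-- determinant and the number of cycles stay the same, while the size drops by one and the sign of
-- the permutation flips.
det-1+signedPerm : ∀ n (f g : Fin n → Fin n) → (∀ i → g (f i) ≡ i) → (∀ i → f (g i) ≡ i) →
  ∀ ε → (∀ i → IsSign (ε i)) → ZeroOr2^cycles n f ε
det-1+signedPerm zero    f g gf fg ε ± = inj₂ (0 , refl , refl)
det-1+signedPerm (suc n) f g gf fg ε ± = byImage (f zero) (g zero) refl refl
  where
  open ≡-Reasoning

  fixed : f zero ≡ zero → ZeroOr2^cycles (suc n) f ε
  fixed f0 = bySign (± zero) (det-1+signedPerm n f′ g′ gf′ fg′ (ε ∘ suc) (± ∘ suc))
    where
    f′ g′ : Fin n → Fin n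
    f′ i = bypass i (f (suc i))
    g′ i = bypass i (g (suc i))
    fs : ∀ i → f (suc i) ≡ suc (f′ i)
    fs i = suc-bypass i λ fi≡0 → 0≢1+n (begin
      zero           ≡⟨ gf zero ⟨
      g (f zero)     ≡⟨ cong g (trans f0 (sym fi≡0)) ⟩
      g (f (suc i))  ≡⟨ gf (suc i) ⟩
      suc i          ∎)
    gs : ∀ i → g (suc i) ≡ suc (g′ i)
    gs i = suc-bypass i λ gi≡0 → 0≢1+n (begin
      zero           ≡⟨ f0 ⟨
      f zero         ≡⟨ cong f gi≡0 ⟨
      f (g (suc i))  ≡⟨ fg (suc i) ⟩
      suc i          ∎)
    gf′ : ∀ i → g′ (f′ i) ≡ i
    gf′ i = suc-injective (begin
      suc (g′ (f′ i))   ≡⟨ gs (f′ i) ⟨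
      g (suc (f′ i))    ≡⟨ cong g (fs i) ⟨
      g (f (suc i))     ≡⟨ gf (suc i) ⟩
      suc i ∎)
    fg′ : ∀ i → f′ (g′ i) ≡ i
    fg′ i = suc-injective (begin
      suc (f′ (g′ i))   ≡⟨ fs (g′ i) ⟨
      f (suc (g′ i))    ≡⟨ cong f (gs i) ⟨
      f (g (suc i))     ≡⟨ fg (suc i) ⟩
      suc i ∎)
    D′ = det n (1+signedPerm f′ (ε ∘ suc))
    det-D : det (suc n) (1+signedPerm f ε) ≡ (1ℤ + ε zero * 1ℤ) * D′
    det-D = begin
      det (suc n) (1+signedPerm f ε)
        ≡⟨ det-firstColumn (1+signedPerm f ε) (λ i → trans
             (cong (λ x → 0ℤ + ε (suc i) * δ x zero) (fs i))
             (cong (λ x → 0ℤ + x) (ℤ.*-zeroʳ (ε (suc i))))) ⟩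
      (1ℤ + ε zero * δ (f zero) zero) * det n (λ i j → 1+signedPerm f ε (suc i) (suc j))
        ≡⟨ cong₂ (λ x d → (1ℤ + ε zero * δ x zero) * d) f0
             (det-cong n λ i j → cong (λ x → δ i j + ε (suc i) * δ x (suc j)) (fs i)) ⟩
      (1ℤ + ε zero * 1ℤ) * D′ ∎
    bySign : IsSign (ε zero) → ZeroOr2^cycles n f′ (ε ∘ suc) → ZeroOr2^cycles (suc n) f ε
    bySign (inj₁ ε≡1) (inj₁ D′≡0) =
      inj₁ (trans det-D (trans (cong ((1ℤ + ε zero * 1ℤ) *_) D′≡0) (ℤ.*-zeroʳ (1ℤ + ε zero * 1ℤ))))
    bySign (inj₁ ε≡1) (inj₂ (c , D′≡2^c , parity)) =
      inj₂ (suc c , trans det-D (cong₂ (λ e d → (1ℤ + e * 1ℤ) * d) ε≡1 D′≡2^c) , (begin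
        -1ℤ * -1ℤ ^ n * det (suc n) (permMatrix f)
          ≡⟨ cong (-1ℤ * -1ℤ ^ n *_) (det-permMatrix-fixed₀ f f′ f0 fs) ⟩
        -1ℤ * -1ℤ ^ n * det n (permMatrix f′)
          ≡⟨ ℤ.*-assoc -1ℤ (-1ℤ ^ n) (det n (permMatrix f′)) ⟩
        -1ℤ * (-1ℤ ^ n * det n (permMatrix f′))
          ≡⟨ cong (-1ℤ *_) parity ⟩
        -1ℤ ^ suc c ∎))
    -- A fixed point of sign -1 gives the factor 1 - 1.
    bySign (inj₂ ε≡-1) _ = inj₁ (trans det-D (cong (λ e → (1ℤ + e * 1ℤ) * D′) ε≡-1))

  moved : ∀ a u → f zero ≡ suc a → g zero ≡ suc u → ZeroOr2^cycles (suc n) f ε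
  moved a u f0 g0 = transfer (det-1+signedPerm n f′ g′ gf′ fg′ ε′ ±′)
    where
    f′ g′ : Fin n → Fin n
    f′ i = bypass a (f (suc i))
    g′ i = bypass u (g (suc i))
    fu≡0 : f (suc u) ≡ zero
    fu≡0 = trans (cong f (sym g0)) (fg zero)
    ga≡0 : g (suc a) ≡ zero
    ga≡0 = trans (cong g (sym f0)) (gf zero)
    gf′ : ∀ i → g′ (f′ i) ≡ i
    gf′ i = go (f (suc i)) refl
      where
      go : ∀ x → f (suc i) ≡ x → bypass u (g (suc (bypass a x))) ≡ i
      go zero    fi rewrite ga≡0 = suc-injective (trans (sym g0) (trans (cong g (sym fi)) (gf (suc i))))
      go (suc b) fi rewrite sym fi | gf (suc i) = refl
    fg′ : ∀ i → f′ (g′ i) ≡ i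
    fg′ i = go (g (suc i)) refl
      where
      go : ∀ x → g (suc i) ≡ x → bypass a (f (suc (bypass u x))) ≡ i
      go zero    gi rewrite fu≡0 = suc-injective (trans (sym f0) (trans (cong f (sym gi)) (fg (suc i))))
      go (suc b) gi rewrite sym gi | fg (suc i) = refl
    -- Only the row of `u`, the one with `f (suc u) ≡ zero`, changes under pivoting: its entry at
    -- `a` becomes minus the product of the signs along the path from `suc u` through zero to
    -- `suc a`.
    sign : Fin (suc n) → ℤ → ℤ
    sign zero    e = - (e * ε zero)
    sign (suc _) e = e
    sign-isSign : ∀ x {e} → IsSign e → IsSign (sign x e)
    sign-isSign zero    e± = neg-*-isSign e± (± zero)
    sign-isSign (suc _) e± = e±
    ε′ : Vector ℤ n
    ε′ i = sign (f (suc i)) (ε (suc i))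
    ±′ : ∀ i → IsSign (ε′ i)
    ±′ i = sign-isSign (f (suc i)) (± (suc i))
    reduce : ∀ d e x j → d + e * δ x (suc j) - e * δ x zero * (0ℤ + ε zero * δ a j) ≡
      d + sign x e * δ (bypass a x) j
    reduce d e zero    j = solve 4 (λ d e e₀ a → d :+ e :* con 0ℤ :- e :* con 1ℤ :* (con 0ℤ :+ e₀ :* a) :=
      d :+ (:- (e :* e₀)) :* a) refl d e (ε zero) (δ a j)
    reduce d e (suc b) j = solve 4 (λ d e b y → d :+ e :* b :- e :* con 0ℤ :* y :=
      d :+ e :* b) refl d e (δ b j) (0ℤ + ε zero * δ a j)
    D′ = det n (1+signedPerm f′ ε′)
    c : Vector ℤ n
    c i = ε (suc i) * δ (f (suc i)) zero
    A = 1+signedPerm f ε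
    A₀₀≡1 : A zero zero ≡ 1ℤ
    A₀₀≡1 rewrite f0 | ℤ.*-zeroʳ (ε zero) = refl
    det-D : det (suc n) A ≡ D′
    det-D = begin
      det (suc n) A
        ≡⟨ det-pivot A c (λ i → begin
             0ℤ + c i ≡⟨ ℤ.+-identityˡ (c i) ⟩
             c i ≡⟨ ℤ.*-identityʳ (c i) ⟨
             c i * 1ℤ ≡⟨ cong (c i *_) A₀₀≡1 ⟨
             c i * A zero zero ∎) ⟩
      A zero zero * det n (λ i j → A (suc i) (suc j) - c i * A zero (suc j))
        ≡⟨ cong₂ _*_ A₀₀≡1 (det-cong n λ i j → trans
             (cong (λ x → A (suc i) (suc j) - c i * (0ℤ + ε zero * δ x (suc j))) f0)
             (reduce (δ i j) (ε (suc i)) (f (suc i)) j)) ⟩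
      1ℤ * D′ ≡⟨ ℤ.*-identityˡ D′ ⟩
      D′ ∎
    -- Precomposing `f` with the exchange of zero and its preimage `suc u` fixes zero and induces
    -- `f′` on the rest, so the two permutation matrices differ by one row exchange.
    fτs : ∀ i → f (transpose zero (suc u) (suc i)) ≡ suc (f′ i)
    fτs i with i ≟ u
    ... | yes refl rewrite fu≡0 = f0
    ... | no i≢u = suc-bypass a λ fi≡0 → i≢u (suc-injective (begin
      suc i          ≡⟨ gf (suc i) ⟨
      g (f (suc i))  ≡⟨ cong g fi≡0 ⟩
      g zero         ≡⟨ g0 ⟩
      suc u          ∎))
    det-P : det (suc n) (permMatrix f) ≡ - det n (permMatrix f′)
    det-P = begin
      det (suc n) (permMatrix f)
        ≡⟨ ℤ.neg-involutive (det (suc n) (permMatrix f)) ⟨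
      - - det (suc n) (permMatrix f)
        ≡⟨ cong -_ (det-swap (suc n) zero (suc u) (λ ()) (permMatrix f)) ⟨
      - det (suc n) (permMatrix (f ∘ transpose zero (suc u)))
        ≡⟨ cong -_ (det-permMatrix-fixed₀ (f ∘ transpose zero (suc u)) f′ fu≡0 fτs) ⟩
      - det n (permMatrix f′) ∎
    transfer : ZeroOr2^cycles n f′ ε′ → ZeroOr2^cycles (suc n) f ε
    transfer (inj₁ D′≡0) = inj₁ (trans det-D D′≡0)
    transfer (inj₂ (k , D′≡2^k , parity)) = inj₂ (k , trans det-D D′≡2^k , (begin
      -1ℤ * -1ℤ ^ n * det (suc n) (permMatrix f)
        ≡⟨ cong (-1ℤ * -1ℤ ^ n *_) det-P ⟩
      -1ℤ * -1ℤ ^ n * - det n (permMatrix f′)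
        ≡⟨ solve 2 (λ s d → con -1ℤ :* s :* (:- d) := s :* d) refl (-1ℤ ^ n) (det n (permMatrix f′)) ⟩
      -1ℤ ^ n * det n (permMatrix f′)
        ≡⟨ parity ⟩
      -1ℤ ^ k ∎))

  byImage : ∀ x y → f zero ≡ x → g zero ≡ y → ZeroOr2^cycles (suc n) f ε
  byImage zero    _       f0 g0 = fixed f0
  byImage (suc a) zero    f0 g0 = contradiction (trans (sym (fg zero)) (trans (cong f g0) f0)) 0≢1+n
  byImage (suc a) (suc u) f0 g0 = moved a u f0 g0

δ-refl : (i : Fin n) → δ i i ≡ 1ℤ
δ-refl i rewrite dec-true (i ≟ i) refl = refl

δ-≢ : {i j : Fin n} → i ≢ j → δ i j ≡ 0ℤ
δ-≢ {i = i} {j} i≢j rewrite dec-false (i ≟ j) i≢j = refl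

det-permMatrix-id : ∀ n → det n (permMatrix id) ≡ 1ℤ
det-permMatrix-id zero    = refl
det-permMatrix-id (suc n) = trans (det-permMatrix-fixed₀ {n} id id refl λ _ → refl) (det-permMatrix-id n)

-- The root `e_p - e_q` has norm 2, so its reflection subtracts from a vector its pairing with the
-- root times the root. On basis vectors this exchanges `e_p` and `e_q`.
reflect-δ : {p q : Fin n} → p ≢ q → ∀ x j →
  δ x j - (δ x p - δ x q) * (δ p j - δ q j) ≡ δ (transpose p q x) j
reflect-δ {p = p} {q} p≢q x j = compare (x ≟ p) (x ≟ q)
  where
  compare : Dec (x ≡ p) → Dec (x ≡ q) →
    δ x j - (δ x p - δ x q) * (δ p j - δ q j) ≡ δ (transpose p q x) j
  compare (yes refl) _ rewrite δ-refl x | δ-≢ p≢q | transpose-matchˡ x q =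
    solve 2 (λ a b → a :- con 1ℤ :* (a :- b) := b) refl (δ x j) (δ q j)
  compare (no _) (yes refl) rewrite δ-refl x | δ-≢ (p≢q ∘ sym) | transpose-matchʳ p x =
    solve 2 (λ a b → a :- con -1ℤ :* (b :- a) := b) refl (δ x j) (δ p j)
  compare (no x≢p) (no x≢q) rewrite δ-≢ x≢p | δ-≢ x≢q | transpose-mismatch p q x≢p x≢q =
    ℤ.+-identityʳ (δ x j)

transpose-involutive : (i j k : Fin n) → transpose i j (transpose i j k) ≡ k
transpose-involutive i j k = trans (cong (transpose i j) (transpose-comm i j k)) (transpose-inverse i j)

↑ˡ≢↑ʳ : ∀ {m n} (i : Fin m) (k : Fin n) → i ↑ˡ n ≢ m ↑ʳ k
↑ˡ≢↑ʳ {m} {n} i k eq with () ← trans (sym (splitAt-↑ˡ m i n)) (trans (cong (splitAt m) eq) (splitAt-↑ʳ m n k))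

-- Each top row may use a bottom row of its own, chosen by `κ`; with an identity block at the bottom
-- right this clears the block above it.
addBottomRows : ∀ N {K} (c : ℤ) (κ : Fin N → Fin K)
  (R : Vector (Vector ℤ (N ℕ.+ K)) N) (S : Vector (Vector ℤ (N ℕ.+ K)) K) →
  det (N ℕ.+ K) ((λ i l → R i l + c * S (κ i) l) ++ᵛ S) ≡ det (N ℕ.+ K) (R ++ᵛ S)
addBottomRows N {K} c κ R S = changeRows Q (λ R → det (N ℕ.+ K) (R ++ᵛ S))
  (λ {R} {R′} R≗ → det-cong (N ℕ.+ K) {R′ ++ᵛ S} {R ++ᵛ S} λ j → agree {R} {R′} j λ i _ → R≗ i)
  (λ i {R} {R′} R≗ (k , R′ᵢ) → det-addRow (i ↑ˡ K) (N ↑ʳ k) (↑ˡ≢↑ʳ i k) c {R ++ᵛ S} {R′ ++ᵛ S}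
    (λ j j≢i → agree {R} {R′} j λ i′ j≡i′ → R≗ i′ λ i′≡i → j≢i (trans j≡i′ (cong (_↑ˡ K) i′≡i)))
    (λ l → begin
      (R′ ++ᵛ S) (i ↑ˡ K) l   ≡⟨ cong (λ r → r l) (lookup-++ˡ R′ S i) ⟩
      R′ i l                  ≡⟨ R′ᵢ l ⟩
      R i l + c * S k l       ≡⟨ cong₂ (λ r s → r l + c * s l) (lookup-++ˡ R S i) (lookup-++ʳ R S k) ⟨
      (R ++ᵛ S) (i ↑ˡ K) l + c * (R ++ᵛ S) (N ↑ʳ k) l ∎))
  λ i → κ i , λ l → refl
  where
  open ≡-Reasoning
  Q : Vector ℤ (N ℕ.+ K) → Vector ℤ (N ℕ.+ K) → Set
  Q r r′ = ∃[ k ] ∀ l → r′ l ≡ r l + c * S k l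
  -- The premise hands over `j ≡ i ↑ˡ K`, from which the caller excludes the row being changed.
  agree : ∀ {R R′} j → (∀ i → j ≡ i ↑ˡ K → R′ i ≗ R i) → (R′ ++ᵛ S) j ≗ (R ++ᵛ S) j
  agree j R≗ with splitAt N j in eq
  ... | inj₁ i = R≗ i (sym (splitAt⁻¹-↑ˡ eq))
  ... | inj₂ k = λ _ → refl

-- Bordered Gram matrices

-- Recursion on `N` instead of `_++ᵛ_`, so that it unfolds in step with `bordered`.
pad : ∀ N {K} → Vector ℤ K → Vector ℤ (N ℕ.+ K)
pad zero    c i       = c i
pad (suc N) c zero    = 0ℤ
pad (suc N) c (suc i) = pad N c i

pad-* : ∀ N {f g : Vector ℤ K} {t} → (∀ k → f k ≡ g k * t) → ∀ i → pad N f i ≡ pad N g i * t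
pad-* zero    f≡gt i       = f≡gt i
pad-* (suc N) {t = t} f≡gt zero    = sym (ℤ.*-zeroˡ t)
pad-* (suc N) f≡gt (suc i) = pad-* N f≡gt i

pad-sub : ∀ N {f c h : Vector ℤ K} {t} → (∀ k → f k - c k * t ≡ h k) →
  ∀ i → pad N f i - pad N c i * t ≡ pad N h i
pad-sub zero    eq i       = eq i
pad-sub (suc N) {t = t} eq zero = solve 1 (λ t → con 0ℤ :- con 0ℤ :* t := con 0ℤ) refl t
pad-sub (suc N) eq (suc i) = pad-sub N eq i

pad-↑ˡ : ∀ N {K} (c : Vector ℤ K) (i : Fin N) → pad N c (i ↑ˡ K) ≡ 0ℤ
pad-↑ˡ (suc N) c zero    = refl
pad-↑ˡ (suc N) c (suc i) = pad-↑ˡ N c i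

pad-↑ʳ : ∀ N {K} (c : Vector ℤ K) k → pad N c (N ↑ʳ k) ≡ c k
pad-↑ʳ zero    c k = refl
pad-↑ʳ (suc N) c k = pad-↑ʳ N c k

module Bordered {A : Set} {K} (p q : A → Fin K) (p≢q : ∀ a → p a ≢ q a) where

  root : A → Vector ℤ K
  root a j = δ (p a) j - δ (q a) j

  -- The inner product of `y` with `root a`, written without a sum.
  ⟨_,_⟩ : Vector ℤ K → A → ℤ
  ⟨ y , a ⟩ = y (p a) - y (q a)

  root-norm : ∀ a → ⟨ root a , a ⟩ ≡ + 2
  root-norm a rewrite δ-refl (p a) | δ-refl (q a) | δ-≢ (p≢q a) | δ-≢ (p≢q a ∘ sym) = refl

  -- Serves two kinds of rows: those of `[ Y Bᵀ , V ]`, and, with `y` twice the root `v`, the part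
  -- of a row of `[ 2L , B ]` to the right of the diagonal.
  borderRow : (as : List A) → Vector ℤ K → Vector ℤ K → Vector ℤ (length as ℕ.+ K)
  borderRow []       y v j       = v j
  borderRow (a ∷ as) y v zero    = ⟨ y , a ⟩
  borderRow (a ∷ as) y v (suc j) = borderRow as y v j

  -- The block matrix [ 2L , B ; Y Bᵀ , V ], where B has the rows root a and L is
  -- upper unitriangular with L + Lᵀ = B Bᵀ.
  bordered : (as : List A) (Y V : SquareMatrix K) → SquareMatrix (length as ℕ.+ K)
  bordered []       Y V = V
  bordered (a ∷ as) Y V zero    zero    = + 2
  bordered (a ∷ as) Y V zero    (suc j) = borderRow as (λ l → + 2 * root a l) (root a) j
  bordered (a ∷ as) Y V (suc i) zero    = pad (length as) (λ k → ⟨ Y k , a ⟩) i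
  bordered (a ∷ as) Y V (suc i) (suc j) = bordered as Y V i j

  borderRow-↑ˡ : ∀ as y v i → borderRow as y v (i ↑ˡ K) ≡ ⟨ y , lookup as i ⟩
  borderRow-↑ˡ (a ∷ as) y v zero    = refl
  borderRow-↑ˡ (a ∷ as) y v (suc i) = borderRow-↑ˡ as y v i

  borderRow-↑ʳ : ∀ as y v k → borderRow as y v (length as ↑ʳ k) ≡ v k
  borderRow-↑ʳ []       y v k = refl
  borderRow-↑ʳ (a ∷ as) y v k = borderRow-↑ʳ as y v k

  borderRow-* : ∀ as c y v {y′ v′} → (∀ l → y′ l ≡ c * y l) → (∀ l → v′ l ≡ c * v l) →
    ∀ j → borderRow as y′ v′ j ≡ c * borderRow as y v j
  borderRow-* []       c y v y′≡ v′≡ j       = v′≡ j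
  borderRow-* (a ∷ as) c y v y′≡ v′≡ zero    = trans (cong₂ _-_ (y′≡ (p a)) (y′≡ (q a)))
    (solve 3 (λ c x y → c :* x :- c :* y := c :* (x :- y)) refl c (y (p a)) (y (q a)))
  borderRow-* (a ∷ as) c y v y′≡ v′≡ (suc j) = borderRow-* as c y v y′≡ v′≡ j

  borderRow-sub : ∀ as (y v y′ v′ : Vector ℤ K) j →
    borderRow as (λ l → y l - y′ l) (λ l → v l - v′ l) j ≡ borderRow as y v j - borderRow as y′ v′ j
  borderRow-sub []       y v y′ v′ j       = refl
  borderRow-sub (a ∷ as) y v y′ v′ zero    =
    solve 4 (λ x x′ y y′ → x :- x′ :- (y :- y′) := x :- y :- (x′ :- y′)) refl (y (p a)) (y′ (p a)) (y (q a)) (y′ (q a))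
  borderRow-sub (a ∷ as) y v y′ v′ (suc j) = borderRow-sub as y v y′ v′ j

  -- Shows that the Schur complement of one root is again bordered. The padded multipliers are 0 on
  -- the rows of the remaining roots, so only `Y` and `V` are updated.
  bordered-sub : ∀ as {Y V Y′ V′ : SquareMatrix K} (c x x′ : Vector ℤ K) →
    (∀ k l → Y k l - c k * x l ≡ Y′ k l) → (∀ k l → V k l - c k * x′ l ≡ V′ k l) →
    ∀ i j → bordered as Y V i j - pad (length as) c i * borderRow as x x′ j ≡ bordered as Y′ V′ i j
  bordered-sub []       c x x′ Y≡ V≡ i j = V≡ i j
  bordered-sub (a ∷ as) c x x′ Y≡ V≡ zero zero =
    solve 1 (λ t → con (+ 2) :- con 0ℤ :* t := con (+ 2)) refl ⟨ x , a ⟩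
  bordered-sub (a ∷ as) c x x′ Y≡ V≡ zero (suc j) =
    solve 2 (λ z t → z :- con 0ℤ :* t := z) refl
      (borderRow as (λ l → + 2 * root a l) (root a) j) (borderRow as x x′ j)
  bordered-sub (a ∷ as) {Y} {V} {Y′} {V′} c x x′ Y≡ V≡ (suc i) zero = pad-sub (length as)
    (λ k → trans
      (solve 5 (λ y z c s t → y :- z :- c :* (s :- t) := y :- c :* s :- (z :- c :* t)) refl
        (Y k (p a)) (Y k (q a)) (c k) (x (p a)) (x (q a)))
      (cong₂ _-_ (Y≡ k (p a)) (Y≡ k (q a)))) i
  bordered-sub (a ∷ as) c x x′ Y≡ V≡ (suc i) (suc j) = bordered-sub as c x x′ Y≡ V≡ i j

  bordered-↑ʳ : ∀ as (Y V : SquareMatrix K) k → bordered as Y V (length as ↑ʳ k) ≗ borderRow as (Y k) (V k)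
  bordered-↑ʳ []       Y V k j       = refl
  bordered-↑ʳ (a ∷ as) Y V k zero    = pad-↑ʳ (length as) (λ k → ⟨ Y k , a ⟩) k
  bordered-↑ʳ (a ∷ as) Y V k (suc j) = bordered-↑ʳ as Y V k j

  bordered-↑ˡ : ∀ as (Y V Y′ V′ : SquareMatrix K) i → bordered as Y V (i ↑ˡ K) ≗ bordered as Y′ V′ (i ↑ˡ K)
  bordered-↑ˡ (a ∷ as) Y V Y′ V′ zero    zero    = refl
  bordered-↑ˡ (a ∷ as) Y V Y′ V′ zero    (suc j) = refl
  bordered-↑ˡ (a ∷ as) Y V Y′ V′ (suc i) zero    =
    trans (pad-↑ˡ (length as) (λ k → ⟨ Y k , a ⟩) i) (sym (pad-↑ˡ (length as) (λ k → ⟨ Y′ k , a ⟩) i))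
  bordered-↑ˡ (a ∷ as) Y V Y′ V′ (suc i) (suc j) = bordered-↑ˡ as Y V Y′ V′ i j

  bordered-corner : ∀ as (Y V : SquareMatrix K) i k →
    bordered as Y V (i ↑ˡ K) (length as ↑ʳ k) ≡ root (lookup as i) k
  bordered-corner (a ∷ as) Y V zero    k = borderRow-↑ʳ as (λ l → + 2 * root a l) (root a) k
  bordered-corner (a ∷ as) Y V (suc i) k = bordered-corner as Y V i k

  reflection : A → Fin K → Fin K
  reflection a = transpose (p a) (q a)

  -- The head of the list acts first, in the order in which `det-bordered` pivots.
  reflections reflections⁻¹ : List A → Fin K → Fin K
  reflections   []       = id
  reflections   (a ∷ as) = reflections as ∘ reflection a
  reflections⁻¹ []       = id
  reflections⁻¹ (a ∷ as) = reflection a ∘ reflections⁻¹ as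

  reflections-inverseˡ : ∀ as k → reflections⁻¹ as (reflections as k) ≡ k
  reflections-inverseˡ []       k = refl
  reflections-inverseˡ (a ∷ as) k = trans
    (cong (reflection a) (reflections-inverseˡ as (reflection a k)))
    (transpose-involutive (p a) (q a) k)

  reflections-inverseʳ : ∀ as k → reflections as (reflections⁻¹ as k) ≡ k
  reflections-inverseʳ []       k = refl
  reflections-inverseʳ (a ∷ as) k = trans
    (cong (reflections as) (transpose-involutive (p a) (q a) (reflections⁻¹ as k)))
    (reflections-inverseʳ as k)

  -- Each reflection exchanges two rows of the permutation matrix.
  det-reflections : ∀ as → det K (permMatrix (reflections as)) ≡ -1ℤ ^ length as
  det-reflections []       = det-permMatrix-id K
  det-reflections (a ∷ as) = begin
    det K (permMatrix (reflections as) ∘ reflection a)  ≡⟨ det-swap K (p a) (q a) (p≢q a) (permMatrix (reflections as)) ⟩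
    - det K (permMatrix (reflections as))               ≡⟨ cong -_ (det-reflections as) ⟩
    - (-1ℤ ^ length as)                                 ≡⟨ ℤ.-1*i≡-i (-1ℤ ^ length as) ⟨
    -1ℤ * -1ℤ ^ length as ∎
    where open ≡-Reasoning

  1⃗ : Vector ℤ K
  1⃗ _ = 1ℤ

  -- Schur complement of 2L: clearing the column of a replaces Y by Y s, with s the
  -- reflection of a, and changes V so that 2V - Y stays constant.
  det-bordered : ∀ as (f : Fin K → Fin K) (Y V : SquareMatrix K) →
    (∀ k l → Y k l ≡ + 2 * δ (f k) l) → (∀ k l → V k l ≡ 1+signedPerm f 1⃗ k l) →
    det _ (bordered as Y V) ≡ (+ 2) ^ length as * det K (1+signedPerm (reflections as ∘ f) 1⃗)
  det-bordered [] f Y V Y≡ V≡ = trans (det-cong K V≡) (sym (ℤ.*-identityˡ _))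
  det-bordered (a ∷ as) f Y V Y≡ V≡ = begin
    det _ (bordered (a ∷ as) Y V)
      ≡⟨ det-pivot (bordered (a ∷ as) Y V) (pad (length as) c) (pad-* (length as) λ k → trans
           (cong₂ _-_ (Y≡ k (p a)) (Y≡ k (q a)))
           (solve 2 (λ x y → con (+ 2) :* x :- con (+ 2) :* y := (x :- y) :* con (+ 2)) refl (δ (f k) (p a)) (δ (f k) (q a)))) ⟩
    + 2 * det _ (λ i j → bordered as Y V i j - pad (length as) c i * borderRow as (λ l → + 2 * root a l) (root a) j)
      ≡⟨ cong (+ 2 *_) (det-cong _ (bordered-sub as c (λ l → + 2 * root a l) (root a) Y-step V-step)) ⟩
    + 2 * det _ (bordered as (λ k l → + 2 * δ (reflection a (f k)) l) (1+signedPerm (reflection a ∘ f) 1⃗))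
      ≡⟨ cong (+ 2 *_) (det-bordered as (reflection a ∘ f) _ _ (λ _ _ → refl) (λ _ _ → refl)) ⟩
    + 2 * ((+ 2) ^ length as * D)
      ≡⟨ ℤ.*-assoc (+ 2) ((+ 2) ^ length as) D ⟨
    (+ 2) ^ length (a ∷ as) * D ∎
    where
    open ≡-Reasoning
    D = det K (1+signedPerm (reflections (a ∷ as) ∘ f) 1⃗)
    -- The factor 2 in `Y` cancels the pivot 2, which keeps the multipliers integral.
    c : Vector ℤ K
    c k = ⟨ δ (f k) , a ⟩
    Y-step : ∀ k l → Y k l - c k * (+ 2 * root a l) ≡ + 2 * δ (reflection a (f k)) l
    Y-step k l = begin
      Y k l - c k * (+ 2 * root a l)
        ≡⟨ cong (_- c k * (+ 2 * root a l)) (Y≡ k l) ⟩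
      + 2 * δ (f k) l - c k * (+ 2 * root a l)
        ≡⟨ solve 3 (λ d c r → con (+ 2) :* d :- c :* (con (+ 2) :* r) := con (+ 2) :* (d :- c :* r)) refl
             (δ (f k) l) (c k) (root a l) ⟩
      + 2 * (δ (f k) l - c k * root a l)
        ≡⟨ cong (+ 2 *_) (reflect-δ (p≢q a) (f k) l) ⟩
      + 2 * δ (reflection a (f k)) l ∎
    V-step : ∀ k l → V k l - c k * root a l ≡ 1+signedPerm (reflection a ∘ f) 1⃗ k l
    V-step k l = begin
      V k l - c k * root a l
        ≡⟨ cong (_- c k * root a l) (V≡ k l) ⟩
      δ k l + 1ℤ * δ (f k) l - c k * root a l
        ≡⟨ solve 4 (λ i d c r → i :+ con 1ℤ :* d :- c :* r := i :+ con 1ℤ :* (d :- c :* r)) refl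
             (δ k l) (δ (f k) l) (c k) (root a l) ⟩
      δ k l + 1ℤ * (δ (f k) l - c k * root a l)
        ≡⟨ cong (λ x → δ k l + 1ℤ * x) (reflect-δ (p≢q a) (f k) l) ⟩
      δ k l + 1ℤ * δ (reflection a (f k)) l ∎

  module _ (entries : A → A → ℤ) (entries-diag : ∀ a → entries a a ≡ 0ℤ) where

    -- The entries of L - Lᵀ for a preceding b.
    Ordered : A → A → Set
    Ordered a b = entries a b ≡ ⟨ root a , b ⟩ × entries b a ≡ - ⟨ root b , a ⟩

    -- This is `2L - B Bᵀ = L - Lᵀ`, entry by entry: 2 - 2 on the diagonal, twice the pairing minus
    -- the pairing above it, and 0 minus the pairing below it.
    bordered-minus-Gram : ∀ {as} → AllPairs Ordered as → ∀ Y V i j →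
      bordered as Y V (i ↑ˡ K) (j ↑ˡ K) - ⟨ root (lookup as i) , lookup as j ⟩ ≡
      entries (lookup as i) (lookup as j)
    bordered-minus-Gram {a ∷ as} (_ ∷ _) Y V zero zero =
      trans (cong (λ x → + 2 - x) (root-norm a)) (sym (entries-diag a))
    bordered-minus-Gram {a ∷ as} (a< ∷ _) Y V zero (suc j) = begin
      borderRow as (λ l → + 2 * root a l) (root a) (j ↑ˡ K) - ⟨ root a , b ⟩
        ≡⟨ cong (_- ⟨ root a , b ⟩) (borderRow-↑ˡ as (λ l → + 2 * root a l) (root a) j) ⟩
      + 2 * root a (p b) - + 2 * root a (q b) - ⟨ root a , b ⟩
        ≡⟨ solve 2 (λ x y → con (+ 2) :* x :- con (+ 2) :* y :- (x :- y) := x :- y) refl (root a (p b)) (root a (q b)) ⟩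
      ⟨ root a , b ⟩
        ≡⟨ proj₁ (All.lookup a< (∈-lookup j)) ⟨
      entries a b ∎
      where
      open ≡-Reasoning
      b = lookup as j
    bordered-minus-Gram {a ∷ as} (a< ∷ _) Y V (suc i) zero = begin
      pad (length as) (λ k → ⟨ Y k , a ⟩) (i ↑ˡ K) - ⟨ root b , a ⟩
        ≡⟨ cong (_- ⟨ root b , a ⟩) (pad-↑ˡ (length as) (λ k → ⟨ Y k , a ⟩) i) ⟩
      0ℤ - ⟨ root b , a ⟩
        ≡⟨ ℤ.+-identityˡ (- ⟨ root b , a ⟩) ⟩
      - ⟨ root b , a ⟩
        ≡⟨ proj₂ (All.lookup a< (∈-lookup i)) ⟨
      entries b a ∎
      where
      open ≡-Reasoning
      b = lookup as i
    bordered-minus-Gram {a ∷ as} (_ ∷ ordered) Y V (suc i) (suc j) = bordered-minus-Gram ordered Y V i j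

    entryMatrix : (as : List A) → SquareMatrix (length as)
    entryMatrix as i j = entries (lookup as i) (lookup as j)

    -- Subtracting `B` times the border rows `[ Bᵀ , I ]` from the top rows `[ 2L , B ]` clears the
    -- upper right block and leaves `2L - B Bᵀ` beside it. The matrix is then block triangular with
    -- lower right block `I`.
    det-bordered-id : ∀ {as} → AllPairs Ordered as →
      det _ (bordered as δ δ) ≡ det (length as) (entryMatrix as)
    det-bordered-id {as} ordered = begin
      det _ (bordered as δ δ)
        ≡⟨ det-cong _ split ⟩
      det _ (top ++ᵛ bottom)
        ≡⟨ addBottomRows N -1ℤ (p ∘ lookup as) top bottom ⟨
      det _ (top₁ ++ᵛ bottom)
        ≡⟨ addBottomRows N 1ℤ (q ∘ lookup as) top₁ bottom ⟨
      det _ (top₂ ++ᵛ bottom)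
        ≡⟨ det-block N (top₂ ++ᵛ bottom) (λ i k → begin
             (top₂ ++ᵛ bottom) (i ↑ˡ K) (N ↑ʳ k)
               ≡⟨ cong (λ r → r (N ↑ʳ k)) (lookup-++ˡ top₂ bottom i) ⟩
             top₂ i (N ↑ʳ k)
               ≡⟨ top₂-sub i (N ↑ʳ k) ⟩
             top i (N ↑ʳ k) - rootRow i (N ↑ʳ k)
               ≡⟨ ℤ.i≡j⇒i-j≡0 (trans (bordered-corner as δ δ i k) (sym (borderRow-↑ʳ as _ _ k))) ⟩
             0ℤ ∎) ⟩
      det N (λ i j → (top₂ ++ᵛ bottom) (i ↑ˡ K) (j ↑ˡ K)) * det K (λ i j → (top₂ ++ᵛ bottom) (N ↑ʳ i) (N ↑ʳ j))
        ≡⟨ cong₂ _*_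
             (det-cong N λ i j → begin
               (top₂ ++ᵛ bottom) (i ↑ˡ K) (j ↑ˡ K)
                 ≡⟨ cong (λ r → r (j ↑ˡ K)) (lookup-++ˡ top₂ bottom i) ⟩
               top₂ i (j ↑ˡ K)
                 ≡⟨ top₂-sub i (j ↑ˡ K) ⟩
               top i (j ↑ˡ K) - rootRow i (j ↑ˡ K)
                 ≡⟨ cong (λ x → top i (j ↑ˡ K) - x) (borderRow-↑ˡ as _ _ j) ⟩
               top i (j ↑ˡ K) - ⟨ root (lookup as i) , lookup as j ⟩
                 ≡⟨ bordered-minus-Gram ordered δ δ i j ⟩
               entryMatrix as i j ∎)
             (trans
               (det-cong K λ i j → trans (cong (λ r → r (N ↑ʳ j)) (lookup-++ʳ top₂ bottom i))
                 (borderRow-↑ʳ as (δ i) (δ i) j))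
               (det-permMatrix-id K)) ⟩
      det N (entryMatrix as) * 1ℤ
        ≡⟨ ℤ.*-identityʳ (det N (entryMatrix as)) ⟩
      det N (entryMatrix as) ∎
      where
      open ≡-Reasoning
      N = length as
      top top₁ top₂ rootRow : Vector (Vector ℤ (N ℕ.+ K)) N
      bottom : Vector (Vector ℤ (N ℕ.+ K)) K
      top i = bordered as δ δ (i ↑ˡ K)
      bottom k = borderRow as (δ k) (δ k)
      -- A root has only the coefficients 1 at `p` and -1 at `q`, so subtracting its combination of
      -- border rows takes two row additions.
      top₁ i l = top i l + -1ℤ * bottom (p (lookup as i)) l
      top₂ i l = top₁ i l + 1ℤ * bottom (q (lookup as i)) l
      rootRow i = borderRow as (root (lookup as i)) (root (lookup as i))
      split : ∀ i → bordered as δ δ i ≗ (top ++ᵛ bottom) i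
      split i with splitAt N i in eq
      ... | inj₁ j = λ l → cong (λ r → bordered as δ δ r l) (sym (splitAt⁻¹-↑ˡ eq))
      ... | inj₂ k = λ l → trans (cong (λ r → bordered as δ δ r l) (sym (splitAt⁻¹-↑ʳ eq))) (bordered-↑ʳ as δ δ k l)
      top₂-sub : ∀ i l → top₂ i l ≡ top i l - rootRow i l
      top₂-sub i l = trans
        (solve 3 (λ t x y → t :+ con -1ℤ :* x :+ con 1ℤ :* y := t :- (x :- y)) refl
          (top i l) (bottom (p (lookup as i)) l) (bottom (q (lookup as i)) l))
        (cong (λ x → top i l - x) (sym (borderRow-sub as (δ (p a)) (δ (p a)) (δ (q a)) (δ (q a)) l)))
        where a = lookup as i

    -- The two evaluations meet here. Doubling the border rows costs `2 ^ K` and makes `2δ` fit both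
    -- hypotheses of `det-bordered` with `f = id`, since `2I = I + I`.
    det-entryMatrix : ∀ {as} → AllPairs Ordered as →
      (+ 2) ^ K * det (length as) (entryMatrix as) ≡
      (+ 2) ^ length as * det K (1+signedPerm (reflections as) 1⃗)
    det-entryMatrix {as} ordered = begin
      (+ 2) ^ K * det (length as) (entryMatrix as)
        ≡⟨ cong ((+ 2) ^ K *_) (det-bordered-id ordered) ⟨
      (+ 2) ^ K * det _ (bordered as δ δ)
        ≡⟨ det-scaleBottom (length as) (+ 2) (bordered-↑ˡ as 2δ 2δ δ δ) (λ k j → begin
             bordered as 2δ 2δ (length as ↑ʳ k) j   ≡⟨ bordered-↑ʳ as 2δ 2δ k j ⟩
             borderRow as (2δ k) (2δ k) j           ≡⟨ borderRow-* as (+ 2) (δ k) (δ k) (λ _ → refl) (λ _ → refl) j ⟩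
             + 2 * borderRow as (δ k) (δ k) j       ≡⟨ cong (+ 2 *_) (bordered-↑ʳ as δ δ k j) ⟨
             + 2 * bordered as δ δ (length as ↑ʳ k) j ∎) ⟨
      det _ (bordered as 2δ 2δ)
        ≡⟨ det-bordered as id 2δ 2δ (λ _ _ → refl)
             (λ k l → solve 1 (λ d → con (+ 2) :* d := d :+ con 1ℤ :* d) refl (δ k l)) ⟩
      (+ 2) ^ length as * det K (1+signedPerm (reflections as) 1⃗) ∎
      where
      open ≡-Reasoning
      2δ : SquareMatrix K
      2δ k l = + 2 * δ k l

-- Parity and powers of 2

-1^n*-1^n≡1 : ∀ n → -1ℤ ^ n * -1ℤ ^ n ≡ 1ℤ
-1^n*-1^n≡1 zero    = refl
-1^n*-1^n≡1 (suc n) = trans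
  (solve 1 (λ s → con -1ℤ :* s :* (con -1ℤ :* s) := s :* s) refl (-1ℤ ^ n)) (-1^n*-1^n≡1 n)

-1^2+n : ∀ n → -1ℤ ^ suc (suc n) ≡ -1ℤ ^ n
-1^2+n n = solve 1 (λ s → con -1ℤ :* (con -1ℤ :* s) := s) refl (-1ℤ ^ n)

-- Evenness is expressed by a power of -1 because the parity information comes from signs of
-- permutations; exponent 1 is excluded by -1 ≢ 1.
2^even : ∀ n → -1ℤ ^ n ≡ 1ℤ → ∃[ k ] (+ 2) ^ n ≡ (+ 4) ^ k
2^even zero          _    = 0 , refl
2^even (suc (suc n)) even with k , 2^n≡4^k ← 2^even n (trans (sym (-1^2+n n)) even) =
  suc k , trans (sym (ℤ.*-assoc (+ 2) (+ 2) ((+ 2) ^ n))) (cong (+ 4 *_) 2^n≡4^k)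

2^K*x≡2^E⇒x≡4^k : ∀ K E x → -1ℤ ^ (K ℕ.+ E) ≡ 1ℤ → (+ 2) ^ K * x ≡ (+ 2) ^ E → ∃[ k ] x ≡ (+ 4) ^ k
2^K*x≡2^E⇒x≡4^k zero E x even eq with k , 2^E≡4^k ← 2^even E even =
  k , trans (sym (ℤ.*-identityˡ x)) (trans eq 2^E≡4^k)
-- Here 2 would divide 1.
2^K*x≡2^E⇒x≡4^k (suc K) zero x even eq = contradiction
  (ℕ.m*n≡1⇒m≡1 2 ∣ (+ 2) ^ K * x ∣ (trans
    (sym (ℤ.abs-* (+ 2) ((+ 2) ^ K * x)))
    (cong ∣_∣ (trans (sym (ℤ.*-assoc (+ 2) ((+ 2) ^ K) x)) eq))))
  λ ()
2^K*x≡2^E⇒x≡4^k (suc K) (suc E) x even eq = 2^K*x≡2^E⇒x≡4^k K E x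
  (trans (sym (-1^2+n (K ℕ.+ E))) (trans (cong (-1ℤ ^_) (cong suc (sym (ℕ.+-suc K E)))) even))
  (ℤ.*-cancelˡ-≡ (+ 2) ((+ 2) ^ K * x) ((+ 2) ^ E) (trans (sym (ℤ.*-assoc (+ 2) ((+ 2) ^ K) x)) eq))

zeroOr4^ : ∀ {K} (h : Fin K → Fin K) ε N x → ZeroOr2^cycles K h ε →
  det K (permMatrix h) ≡ -1ℤ ^ N → (+ 2) ^ K * x ≡ (+ 2) ^ N * det K (1+signedPerm h ε) →
  x ≡ 0ℤ ⊎ (∃[ k ] x ≡ (+ 4) ^ k)
zeroOr4^ {K} h ε N x (inj₁ D≡0) _ eq
  with ℤ.i*j≡0⇒i≡0∨j≡0 ((+ 2) ^ K) (trans eq (trans (cong ((+ 2) ^ N *_) D≡0) (ℤ.*-zeroʳ ((+ 2) ^ N))))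
... | inj₁ 2^K≡0 = contradiction (ℤ.i^n≡0⇒i≡0 (+ 2) K 2^K≡0) λ ()
... | inj₂ x≡0   = inj₁ x≡0
zeroOr4^ {K} h ε N x (inj₂ (c , D≡2^c , parity)) sign eq = inj₂ (2^K*x≡2^E⇒x≡4^k K (N ℕ.+ c) x even (begin
  (+ 2) ^ K * x                           ≡⟨ eq ⟩
  (+ 2) ^ N * det K (1+signedPerm h ε)    ≡⟨ cong ((+ 2) ^ N *_) D≡2^c ⟩
  (+ 2) ^ N * (+ 2) ^ c                   ≡⟨ ℤ.^-distribˡ-+-* (+ 2) N c ⟨
  (+ 2) ^ (N ℕ.+ c) ∎))
  where
  open ≡-Reasoning
  -- The sum has the parity of the exponent `N + c - K` and avoids subtraction.
  even : -1ℤ ^ (K ℕ.+ (N ℕ.+ c)) ≡ 1ℤ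
  even = begin
    -1ℤ ^ (K ℕ.+ (N ℕ.+ c))                  ≡⟨ ℤ.^-distribˡ-+-* -1ℤ K (N ℕ.+ c) ⟩
    -1ℤ ^ K * -1ℤ ^ (N ℕ.+ c)                ≡⟨ cong (-1ℤ ^ K *_) (ℤ.^-distribˡ-+-* -1ℤ N c) ⟩
    -1ℤ ^ K * (-1ℤ ^ N * -1ℤ ^ c)            ≡⟨ ℤ.*-assoc (-1ℤ ^ K) (-1ℤ ^ N) (-1ℤ ^ c) ⟨
    -1ℤ ^ K * -1ℤ ^ N * -1ℤ ^ c              ≡⟨ cong (λ d → -1ℤ ^ K * d * -1ℤ ^ c) sign ⟨
    -1ℤ ^ K * det K (permMatrix h) * -1ℤ ^ c ≡⟨ cong (_* -1ℤ ^ c) parity ⟩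
    -1ℤ ^ c * -1ℤ ^ c                        ≡⟨ -1^n*-1^n≡1 c ⟩
    1ℤ ∎

-- Diagrams

-- Pairs headed by `x` are compared in the second component, and they precede all later pairs by the
-- first.
cartesianProduct-lex : ∀ {A B : Set} {_<₁_ : A → A → Set} {_<₂_ : B → B → Set} {xs ys} →
  AllPairs _<₁_ xs → AllPairs _<₂_ ys → AllPairs (×-Lex _≡_ _<₁_ _<₂_) (cartesianProduct xs ys)
cartesianProduct-lex [] _ = []
cartesianProduct-lex {xs = x ∷ xs} {ys} (x< ∷ xs<) ys< = AllPairs.++⁺
  (AllPairs.map⁺ (AllPairsBase.map (λ y<y′ → inj₂ (refl , y<y′)) ys<))
  (cartesianProduct-lex xs< ys<)
  (All.map⁺ (All.universal (λ _ → All.cartesianProduct⁺ (setoid _) (setoid _) xs ys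
    λ x′∈xs _ → inj₁ (All.lookup x< x′∈xs)) ys))

whiteSquares-lex : ∀ {m n} (D : Diagram m n) → AllPairs (×-Lex _≡_ _<_ _<_) (whiteSquares D)
whiteSquares-lex D = AllPairs.filter⁺ (λ s → isWhite? (D (row s) (col s)))
  (cartesianProduct-lex (AllPairs.tabulate⁺-< id) (AllPairs.tabulate⁺-< id))

entry-precedes : ∀ {m n} (s t : Square m n) → Precedes s t → ¬ Precedes t s → entry s t ≡ 1ℤ × entry t s ≡ -1ℤ
entry-precedes s t s≺t t⊀s
  rewrite dec-true (precedes? s t) s≺t | dec-false (precedes? t s) t⊀s = refl , refl

entry-unrelated : ∀ {m n} (s t : Square m n) → ¬ Precedes s t → ¬ Precedes t s → entry s t ≡ 0ℤ × entry t s ≡ 0ℤ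
entry-unrelated s t s⊀t t⊀s
  rewrite dec-false (precedes? s t) s⊀t | dec-false (precedes? t s) t⊀s = refl , refl

precedes-irrefl : ∀ {m n} (s : Square m n) → ¬ Precedes s s
precedes-irrefl s (inj₁ (_ , c<c)) = <-irrefl refl c<c
precedes-irrefl s (inj₂ (_ , r<r)) = <-irrefl refl r<r

entry-diag : ∀ {m n} (s : Square m n) → entry s s ≡ 0ℤ
entry-diag s = proj₁ (entry-unrelated s s (precedes-irrefl s) (precedes-irrefl s))

-- If two squares share a row or a column, the lexicographically earlier one is to the left or
-- above. Distinct squares never share both, so the sum of the two `δ` is 0 or 1.
entry-lex : ∀ {m n} {s t : Square m n} → ×-Lex _≡_ _<_ _<_ s t →
  entry s t ≡ δ (row s) (row t) + δ (col s) (col t) × entry t s ≡ - (δ (row s) (row t) + δ (col s) (col t))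
entry-lex {s = r , c} {.r , c′} (inj₂ (refl , c<c′))
  rewrite δ-refl r | δ-≢ (<⇒≢ c<c′) = entry-precedes (r , c) (r , c′) (inj₁ (refl , c<c′)) λ
    { (inj₁ (_ , c′<c)) → <-asym c<c′ c′<c
    ; (inj₂ (_ , r<r))  → <-irrefl refl r<r }
entry-lex {s = r , c} {r′ , c′} (inj₁ r<r′) = compare (c ≟ c′)
  where
  compare : Dec (c ≡ c′) →
    entry (r , c) (r′ , c′) ≡ δ r r′ + δ c c′ × entry (r′ , c′) (r , c) ≡ - (δ r r′ + δ c c′)
  compare (yes refl) rewrite δ-refl c | δ-≢ (<⇒≢ r<r′) = entry-precedes (r , c) (r′ , c) (inj₂ (refl , r<r′)) λ
    { (inj₁ (_ , c<c))  → <-irrefl refl c<c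
    ; (inj₂ (_ , r′<r)) → <-asym r<r′ r′<r }
  compare (no c≢c′) rewrite δ-≢ c≢c′ | δ-≢ (<⇒≢ r<r′) = entry-unrelated (r , c) (r′ , c′)
    (λ { (inj₁ (r≡r′ , _)) → <⇒≢ r<r′ r≡r′ ; (inj₂ (c≡c′ , _)) → c≢c′ c≡c′ })
    (λ { (inj₁ (r′≡r , _)) → <⇒≢ r<r′ (sym r′≡r) ; (inj₂ (c′≡c , _)) → c≢c′ (sym c′≡c) })

δ-injective : ∀ {a b} {ι : Fin a → Fin b} → (∀ i j → ι i ≡ ι j → i ≡ j) → ∀ i j → δ (ι i) (ι j) ≡ δ i j
δ-injective {ι = ι} ι-inj i j = compare (i ≟ j)
  where
  compare : Dec (i ≡ j) → δ (ι i) (ι j) ≡ δ i j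
  compare (yes refl) = trans (δ-refl (ι i)) (sym (δ-refl i))
  compare (no i≢j)   = trans (δ-≢ (i≢j ∘ ι-inj i j)) (sym (δ-≢ i≢j))

δ-sym : (i j : Fin n) → δ i j ≡ δ j i
δ-sym i j = compare (i ≟ j)
  where
  compare : Dec (i ≡ j) → δ i j ≡ δ j i
  compare (yes refl) = refl
  compare (no i≢j)   = trans (δ-≢ i≢j) (sym (δ-≢ (i≢j ∘ sym)))

theorem2p2 : (m n : ℕ) (D : Diagram m n) →
    det (#white D) (skewAdjacency D) ≡ 0ℤ ⊎
    (∃[ k ] det (#white D) (skewAdjacency D) ≡ (+ 4) ^ k)
theorem2p2 m n D = zeroOr4^ (reflections ws) 1⃗ (#white D) (det (#white D) (skewAdjacency D))
  -- All signs start as 1; the sign -1 arises only inside the induction.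
  (det-1+signedPerm (m ℕ.+ n) (reflections ws) (reflections⁻¹ ws)
    (reflections-inverseˡ ws) (reflections-inverseʳ ws) 1⃗ λ _ → inj₁ refl)
  (det-reflections ws)
  (det-entryMatrix entry entry-diag (AllPairsBase.map ordered (whiteSquares-lex D)))
  where
  ws = whiteSquares D

  rowPoint colPoint : Square m n → Fin (m ℕ.+ n)
  rowPoint s = row s ↑ˡ n
  colPoint s = m ↑ʳ col s

  open Bordered rowPoint colPoint (λ s → ↑ˡ≢↑ʳ (row s) (col s))

  -- Row points differ from column points, so the cross terms vanish; the column term is positive
  -- because both roots are negative there.
  root-pairing : ∀ s t → ⟨ root s , t ⟩ ≡ δ (row s) (row t) + δ (col s) (col t)
  root-pairing s t
    rewrite δ-injective (↑ˡ-injective n) (row s) (row t) | δ-injective (↑ʳ-injective m) (col s) (col t)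
          | δ-≢ (↑ˡ≢↑ʳ (row s) (col t)) | δ-≢ (↑ˡ≢↑ʳ (row t) (col s) ∘ sym)
    = solve 2 (λ x y → x :- con 0ℤ :- (con 0ℤ :- y) := x :+ y) refl (δ (row s) (row t)) (δ (col s) (col t))

  ordered : ∀ {s t} → ×-Lex _≡_ _<_ _<_ s t → Ordered entry entry-diag s t
  ordered {s} {t} s<t with st , ts ← entry-lex s<t =
    trans st (sym (root-pairing s t)) ,
    trans ts (cong -_ (trans (cong₂ _+_ (δ-sym (row s) (row t)) (δ-sym (col s) (col t))) (sym (root-pairing t s))))
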